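{- The assignments $\mathbf{B}\mapsto\mathbf{R}(\mathbf{B})$ (from basic algebras to Łukasiewicz near semirings) and $\mathbf{R}\mapsto\mathbf{B}(\mathbf{R})$ (from Łukasiewicz near semirings to basic algebras) are mutually inverse: for every basic algebra $\mathbf{B}$ one has $\mathbf{B}(\mathbf{R}(\mathbf{B}))=\mathbf{B}$, and for every Łukasiewicz near semiring $\mathbf{R}$ one has $\mathbf{R}(\mathbf{B}(\mathbf{R}))=\mathbf{R}$ (equality of all operations on the same universe).
   Context: A near semiring is an algebra $\langle R,+,\cdot,0,1\rangle$ such that: (i) $\langle R,+,0\rangle$ is a commutative monoid; (ii) $x\cdot 1=x=1\cdot x$ (multiplication need not be associative or commutative); (iii) $(x+y)\cdot z=(x\cdot z)+(y\cdot z)$; (iv) $x\cdot 0=0\cdot x=0$. It is idempotent if $x+x=x$; then $x\le y$ iff $x+y=y$ defines a partial order, called the induced order. An involutive near semiring is an idempotent near semiring with a map $\alpha:R\to R$ such that $\alpha(\alpha(x))=x$, and $x\le y$ implies $\alpha(y)\le\alpha(x)$. A Łukasiewicz near semiring is an involutive near semiring satisfying the identity $\alpha(x\cdot\alpha(y))\cdot\alpha(y)=\alpha(y\cdot\alpha(x))\cdot\alpha(x)$. A basic algebra is an algebra $\langle A,\oplus,{}',0\rangle$ of type $\langle 2,1,0\rangle$ satisfying, with $1:=0'$: (BA1) $x\oplus 0=x$; (BA2) $x''=x$; (BA3) $(x'\oplus y)'\oplus y=(y'\oplus x)'\oplus x$; (BA4) $(((x\oplus y)'\oplus y)'\oplus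 z)'\oplus(x\oplus z)=1$. For a Łukasiewicz near semiring $\mathbf{R}=\langle R,+,\cdot,0,1,\alpha\rangle$, $\mathbf{B}(\mathbf{R})=\langle R,\oplus,\alpha,0\rangle$ with $x\oplus y=\alpha((\alpha(x)+y)\cdot\alpha(y))$; it is a basic algebra with $x'=\alpha(x)$. For a basic algebra $\mathbf{B}=\langle B,\oplus,{}',0\rangle$, $\mathbf{R}(\mathbf{B})=\langle B,+,\cdot,\alpha,0,1\rangle$ with $x+y=(x'\oplus y)'\oplus y$, $x\cdot y=(x'\oplus y')'$, $\alpha(x)=x'$, $1=0'$; it is a Łukasiewicz near semiring. -}

module Defs where

open import Algebra.Core using (Op₁; Op₂)
open import Algebra.Definitions
open import Algebra.Structures using (IsCommutativeMonoid)
open import Data.Product using (_,_; proj₁; proj₂)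
open import Level using (Level; _⊔_; suc)
open import Relation.Binary.Bundles using (Setoid)
open import Relation.Binary.Core using (Rel)
open import Relation.Binary.Structures using (IsEquivalence)
import Relation.Binary.Reasoning.Setoid as SetoidReasoning

private
  variable
    a c ℓ : Level

-- Unlike `Algebra.Structures.IsNearSemiring`, addition is commutative, there is
-- a unit for multiplication, and multiplication is not assumed associative.
record IsUnitalNearSemiring {A : Set a} (_≈_ : Rel A ℓ)
                            (_+_ _*_ : Op₂ A) (0# 1# : A) : Set (a ⊔ ℓ) where
  field
    +-isCommutativeMonoid : IsCommutativeMonoid _≈_ _+_ 0#
    *-cong                : Congruent₂ _≈_ _*_
    *-identity            : Identity _≈_ 1# _*_
    distribʳ              : _DistributesOverʳ_ _≈_ _*_ _+_
    zero                  : Zero _≈_ 0# _*_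

  open IsCommutativeMonoid +-isCommutativeMonoid public
    using (isEquivalence; refl; sym; trans; setoid)
    renaming
    ( ∙-cong    to +-cong
    ; assoc     to +-assoc
    ; comm      to +-comm
    ; identityˡ to +-identityˡ
    ; identityʳ to +-identityʳ
    )

record IsIdempotentNearSemiring {A : Set a} (_≈_ : Rel A ℓ)
                                (_+_ _*_ : Op₂ A) (0# 1# : A) : Set (a ⊔ ℓ) where
  field
    isUnitalNearSemiring : IsUnitalNearSemiring _≈_ _+_ _*_ 0# 1#
    +-idem               : Idempotent _≈_ _+_

  open IsUnitalNearSemiring isUnitalNearSemiring public

  infix 4 _≤_
  _≤_ : Rel A ℓ
  x ≤ y = (x + y) ≈ y

record IsInvolutiveNearSemiring {A : Set a} (_≈_ : Rel A ℓ)
                                (_+_ _*_ : Op₂ A) (α : Op₁ A) (0# 1# : A) : Set (a ⊔ ℓ) where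
  field
    isIdempotentNearSemiring : IsIdempotentNearSemiring _≈_ _+_ _*_ 0# 1#

  open IsIdempotentNearSemiring isIdempotentNearSemiring public

  field
    α-cong       : Congruent₁ _≈_ α
    α-involutive : Involutive _≈_ α
    α-antitone   : ∀ {x y} → x ≤ y → α y ≤ α x

record IsŁukasiewiczNearSemiring {A : Set a} (_≈_ : Rel A ℓ)
                                 (_+_ _*_ : Op₂ A) (α : Op₁ A) (0# 1# : A) : Set (a ⊔ ℓ) where
  field
    isInvolutiveNearSemiring : IsInvolutiveNearSemiring _≈_ _+_ _*_ α 0# 1#
    łukasiewicz : ∀ x y → (α (x * α y) * α y) ≈ (α (y * α x) * α x)

  open IsInvolutiveNearSemiring isInvolutiveNearSemiring public

record ŁukasiewiczNearSemiring c ℓ : Set (suc (c ⊔ ℓ)) where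
  infixl 7 _*_
  infixl 6 _+_
  infix  4 _≈_
  field
    Carrier : Set c
    _≈_     : Rel Carrier ℓ
    _+_     : Op₂ Carrier
    _*_     : Op₂ Carrier
    α       : Op₁ Carrier
    0#      : Carrier
    1#      : Carrier
    isŁukasiewiczNearSemiring : IsŁukasiewiczNearSemiring _≈_ _+_ _*_ α 0# 1#

  open IsŁukasiewiczNearSemiring isŁukasiewiczNearSemiring public

record IsBasicAlgebra {A : Set a} (_≈_ : Rel A ℓ)
                      (_⊕_ : Op₂ A) (_′ : Op₁ A) (0# : A) : Set (a ⊔ ℓ) where
  field
    isEquivalence : IsEquivalence _≈_
    ⊕-cong        : Congruent₂ _≈_ _⊕_
    ′-cong        : Congruent₁ _≈_ _′
    BA1 : ∀ x → (x ⊕ 0#) ≈ x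
    BA2 : ∀ x → ((x ′) ′) ≈ x
    BA3 : ∀ x y → ((((x ′) ⊕ y) ′) ⊕ y) ≈ ((((y ′) ⊕ x) ′) ⊕ x)
    BA4 : ∀ x y z → (((((((x ⊕ y) ′) ⊕ y) ′) ⊕ z) ′) ⊕ (x ⊕ z)) ≈ (0# ′)

  open IsEquivalence isEquivalence public

  setoid : Setoid a ℓ
  setoid = record { isEquivalence = isEquivalence }

record BasicAlgebra c ℓ : Set (suc (c ⊔ ℓ)) where
  infix  8 _′
  infixl 6 _⊕_
  infix  4 _≈_
  field
    Carrier : Set c
    _≈_     : Rel Carrier ℓ
    _⊕_     : Op₂ Carrier
    _′      : Op₁ Carrier
    0#      : Carrier
    isBasicAlgebra : IsBasicAlgebra _≈_ _⊕_ _′ 0#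

  open IsBasicAlgebra isBasicAlgebra public

  1# : Carrier
  1# = 0# ′

module FromŁukasiewicz (R : ŁukasiewiczNearSemiring c ℓ) where
  open ŁukasiewiczNearSemiring R
  open SetoidReasoning setoid

  infixl 6 _⊕_
  _⊕_ : Op₂ Carrier
  x ⊕ y = α ((α x + y) * α y)

  *-congˡ : ∀ {x y z} → y ≈ z → x * y ≈ x * z
  *-congˡ p = *-cong refl p

  *-congʳ : ∀ {x y z} → y ≈ z → y * x ≈ z * x
  *-congʳ p = *-cong p refl

  *-identityˡ = proj₁ *-identity
  *-identityʳ = proj₂ *-identity
  zeroˡ = proj₁ zero
  zeroʳ = proj₂ zero

  *-monoˡ : ∀ {x y} z → x ≤ y → x * z ≤ y * z
  *-monoˡ {x} {y} z p = trans (sym (distribʳ z x y)) (*-congʳ p)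

  y≤x+y : ∀ x y → y ≤ x + y
  y≤x+y x y = begin
    y + (x + y)  ≈⟨ +-comm y (x + y) ⟩
    (x + y) + y  ≈⟨ +-assoc x y y ⟩
    x + (y + y)  ≈⟨ +-cong refl (+-idem y) ⟩
    x + y        ∎

  +-monoˡ : ∀ {x y} z → x ≤ y → x + z ≤ y + z
  +-monoˡ {x} {y} z p = begin
    (x + z) + (y + z)  ≈⟨ +-assoc x z (y + z) ⟩
    x + (z + (y + z))  ≈⟨ +-cong refl (y≤x+y y z) ⟩
    x + (y + z)        ≈⟨ +-assoc x y z ⟨
    (x + y) + z        ≈⟨ +-cong p refl ⟩
    y + z              ∎

  x≤α0 : ∀ x → x ≤ α 0#
  x≤α0 x = begin
    x + α 0#            ≈⟨ +-cong (α-involutive x) refl ⟨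
    α (α x) + α 0#      ≈⟨ α-antitone (+-identityˡ (α x)) ⟩
    α 0#                ∎

  α0≈1 : α 0# ≈ 1#
  α0≈1 = begin
    α 0#      ≈⟨ α-cong α1≈0 ⟨
    α (α 1#)  ≈⟨ α-involutive 1# ⟩
    1#        ∎
    where
    α0*α1≈0 : α 0# * α 1# ≈ 0#
    α0*α1≈0 = begin
      α 0# * α 1#             ≈⟨ *-congʳ (α-cong (zeroˡ (α 1#))) ⟨
      α (0# * α 1#) * α 1#    ≈⟨ łukasiewicz 0# 1# ⟩
      α (1# * α 0#) * α 0#    ≈⟨ *-congʳ (α-cong (*-identityˡ (α 0#))) ⟩
      α (α 0#) * α 0#         ≈⟨ *-congʳ (α-involutive 0#) ⟩
      0# * α 0#               ≈⟨ zeroˡ (α 0#) ⟩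
      0#                      ∎

    α1≈0 : α 1# ≈ 0#
    α1≈0 = begin
      α 1#                       ≈⟨ +-identityʳ (α 1#) ⟨
      α 1# + 0#                  ≈⟨ +-cong (*-identityˡ (α 1#)) α0*α1≈0 ⟨
      1# * α 1# + α 0# * α 1#    ≈⟨ *-monoˡ (α 1#) (x≤α0 1#) ⟩
      α 0# * α 1#                ≈⟨ α0*α1≈0 ⟩
      0#                         ∎

  α1≈0 : α 1# ≈ 0#
  α1≈0 = trans (α-cong (sym α0≈1)) (α-involutive 0#)

  x*αx≈0 : ∀ x → x * α x ≈ 0#
  x*αx≈0 x = begin
    x * α x                ≈⟨ *-congʳ (α-involutive x) ⟨
    α (α x) * α x          ≈⟨ *-congʳ (α-cong (*-identityˡ (α x))) ⟨
    α (1# * α x) * α x     ≈⟨ łukasiewicz x 1# ⟨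
    α (x * α 1#) * α 1#    ≈⟨ *-congˡ α1≈0 ⟩
    α (x * α 1#) * 0#      ≈⟨ zeroʳ _ ⟩
    0#                     ∎

  ⊕-cong′ : Congruent₂ _≈_ _⊕_
  ⊕-cong′ p q = α-cong (*-cong (+-cong (α-cong p) q) (α-cong q))

  join : ∀ x y → α (α x ⊕ y) ⊕ y ≈ x + y
  join x y = begin
    α ((α (α (α x ⊕ y)) + y) * α y)  ≈⟨ α-cong (*-congʳ (+-cong (α-involutive (α x ⊕ y)) refl)) ⟩
    α ((α x ⊕ y + y) * α y)          ≈⟨ α-cong (*-congʳ (+-cong αx⊕y refl)) ⟩
    α ((α (s * α y) + y) * α y)      ≈⟨ α-cong (*-congʳ (trans (+-comm _ y) y≤)) ⟩
    α (α (s * α y) * α y)            ≈⟨ α-cong (łukasiewicz s y) ⟩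
    α (α (y * α s) * α s)            ≈⟨ α-cong (*-congʳ (α-cong y*αs≈0)) ⟩
    α (α 0# * α s)                   ≈⟨ α-cong (*-congʳ α0≈1) ⟩
    α (1# * α s)                     ≈⟨ α-cong (*-identityˡ (α s)) ⟩
    α (α s)                          ≈⟨ α-involutive s ⟩
    s                                ∎
    where
    s = x + y

    αx⊕y : α x ⊕ y ≈ α (s * α y)
    αx⊕y = α-cong (*-congʳ (+-cong (α-involutive x) refl))

    s*αy≤αy : s * α y ≤ α y
    s*αy≤αy = begin
      s * α y + α y         ≈⟨ +-cong refl (*-identityˡ (α y)) ⟨
      s * α y + 1# * α y    ≈⟨ *-monoˡ (α y) (trans (+-cong refl (sym α0≈1)) (trans (x≤α0 s) α0≈1)) ⟩
      1# * α y              ≈⟨ *-identityˡ (α y) ⟩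
      α y                   ∎

    y≤ : y ≤ α (s * α y)
    y≤ = trans (+-cong (sym (α-involutive y)) refl) (α-antitone s*αy≤αy)

    y*αs≈0 : y * α s ≈ 0#
    y*αs≈0 = begin
      y * α s              ≈⟨ +-identityʳ _ ⟨
      y * α s + 0#         ≈⟨ +-cong refl (x*αx≈0 s) ⟨
      y * α s + s * α s    ≈⟨ *-monoˡ (α s) (y≤x+y x y) ⟩
      s * α s              ≈⟨ x*αx≈0 s ⟩
      0#                   ∎

  BA1 : ∀ x → x ⊕ 0# ≈ x
  BA1 x = begin
    α ((α x + 0#) * α 0#)  ≈⟨ α-cong (*-cong (+-identityʳ (α x)) α0≈1) ⟩
    α (α x * 1#)           ≈⟨ α-cong (*-identityʳ (α x)) ⟩
    α (α x)                ≈⟨ α-involutive x ⟩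
    x                      ∎

  ⊕-monoˡ : ∀ {x y} z → x ≤ y → x ⊕ z ≤ y ⊕ z
  ⊕-monoˡ z p = α-antitone (*-monoˡ (α z) (+-monoˡ z (α-antitone p)))

  ≤⇒α⊕≈α0 : ∀ {x y} → x ≤ y → α x ⊕ y ≈ α 0#
  ≤⇒α⊕≈α0 {x} {y} p = begin
    α ((α (α x) + y) * α y)  ≈⟨ α-cong (*-congʳ (+-cong (α-involutive x) refl)) ⟩
    α ((x + y) * α y)        ≈⟨ α-cong (*-congʳ p) ⟩
    α (y * α y)              ≈⟨ α-cong (x*αx≈0 y) ⟩
    α 0#                     ∎

  α[x⊕y]⊕y : ∀ x y → α (x ⊕ y) ⊕ y ≈ α x + y
  α[x⊕y]⊕y x y =
    trans (⊕-cong′ (α-cong (⊕-cong′ (sym (α-involutive x)) refl)) refl) (join (α x) y)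

  BA4 : ∀ x y z → α (α (α (x ⊕ y) ⊕ y) ⊕ z) ⊕ (x ⊕ z) ≈ α 0#
  BA4 x y z = ≤⇒α⊕≈α0 (⊕-monoˡ z below)
    where
    αx≤ : α x ≤ α (x ⊕ y) ⊕ y
    αx≤ = begin
      α x + (α (x ⊕ y) ⊕ y)  ≈⟨ +-cong refl (α[x⊕y]⊕y x y) ⟩
      α x + (α x + y)        ≈⟨ +-assoc (α x) (α x) y ⟨
      (α x + α x) + y        ≈⟨ +-cong (+-idem (α x)) refl ⟩
      α x + y                ≈⟨ α[x⊕y]⊕y x y ⟨
      α (x ⊕ y) ⊕ y          ∎

    below : α (α (x ⊕ y) ⊕ y) ≤ x
    below = begin
      α (α (x ⊕ y) ⊕ y) + x          ≈⟨ +-cong refl (α-involutive x) ⟨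
      α (α (x ⊕ y) ⊕ y) + α (α x)    ≈⟨ α-antitone αx≤ ⟩
      α (α x)                        ≈⟨ α-involutive x ⟩
      x                              ∎

  basicAlgebra : BasicAlgebra c ℓ
  basicAlgebra = record
    { Carrier = Carrier
    ; _≈_     = _≈_
    ; _⊕_     = _⊕_
    ; _′      = α
    ; 0#      = 0#
    ; isBasicAlgebra = record
      { isEquivalence = isEquivalence
      ; ⊕-cong = ⊕-cong′
      ; ′-cong = α-cong
      ; BA1 = BA1
      ; BA2 = α-involutive
      ; BA3 = λ x y → trans (join x y) (trans (+-comm x y) (sym (join y x)))
      ; BA4 = BA4
      }
    }

module FromBasicAlgebra (B : BasicAlgebra c ℓ) where
  open BasicAlgebra B
  open SetoidReasoning setoid

  infixl 6 _+_
  infixl 7 _*_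

  _+_ : Op₂ Carrier
  x + y = (x ′ ⊕ y) ′ ⊕ y

  _*_ : Op₂ Carrier
  x * y = (x ′ ⊕ y ′) ′

  ⊕-congˡ : ∀ {x y z} → y ≈ z → x ⊕ y ≈ x ⊕ z
  ⊕-congˡ p = ⊕-cong refl p

  ⊕-congʳ : ∀ {x y z} → y ≈ z → y ⊕ x ≈ z ⊕ x
  ⊕-congʳ p = ⊕-cong p refl

  +-cong : Congruent₂ _≈_ _+_
  +-cong p q = ⊕-cong (′-cong (⊕-cong (′-cong p) q)) q

  1⊕x′⊕x : ∀ x → (1# ⊕ x) ′ ⊕ x ≈ x
  1⊕x′⊕x x = begin
    (0# ′ ⊕ x) ′ ⊕ x    ≈⟨ BA3 x 0# ⟨
    (x ′ ⊕ 0#) ′ ⊕ 0#   ≈⟨ BA1 _ ⟩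
    (x ′ ⊕ 0#) ′        ≈⟨ ′-cong (BA1 _) ⟩
    x ′ ′               ≈⟨ BA2 x ⟩
    x                   ∎

  BA4-0 : ∀ x y → ((x ⊕ y) ′ ⊕ y) ⊕ x ≈ 1#
  BA4-0 x y = begin
    ((x ⊕ y) ′ ⊕ y) ⊕ x                        ≈⟨ ⊕-cong (trans (′-cong (BA1 _)) (BA2 _)) (BA1 x) ⟨
    (((x ⊕ y) ′ ⊕ y) ′ ⊕ 0#) ′ ⊕ (x ⊕ 0#)      ≈⟨ BA4 x y 0# ⟩
    1#                                         ∎

  x⊕1≈1 : ∀ x → x ⊕ 1# ≈ 1#
  x⊕1≈1 x = begin
    x ⊕ 1#                    ≈⟨ ⊕-congʳ (1⊕x′⊕x x) ⟨
    ((1# ⊕ x) ′ ⊕ x) ⊕ 1#     ≈⟨ BA4-0 1# x ⟩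
    1#                        ∎

  1⊕x≈1 : ∀ x → 1# ⊕ x ≈ 1#
  1⊕x≈1 x = begin
    1# ⊕ x                    ≈⟨ ⊕-congʳ (x⊕1≈1 _) ⟨
    ((x ⊕ 1#) ′ ⊕ 1#) ⊕ x     ≈⟨ BA4-0 x 1# ⟩
    1#                        ∎

  1′≈0 : 1# ′ ≈ 0#
  1′≈0 = BA2 0#

  0⊕x≈x : ∀ x → 0# ⊕ x ≈ x
  0⊕x≈x x = begin
    0# ⊕ x            ≈⟨ ⊕-congʳ (trans (′-cong (1⊕x≈1 x)) 1′≈0) ⟨
    (1# ⊕ x) ′ ⊕ x    ≈⟨ 1⊕x′⊕x x ⟩
    x                 ∎

  1′⊕x≈x : ∀ x → 1# ′ ⊕ x ≈ x
  1′⊕x≈x x = trans (⊕-congʳ 1′≈0) (0⊕x≈x x)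

  infix 4 _⊑_
  _⊑_ : Rel Carrier _
  x ⊑ y = x ′ ⊕ y ≈ 1#

  ⊑⇒+≈ : ∀ {x y} → x ⊑ y → x + y ≈ y
  ⊑⇒+≈ p = trans (⊕-congʳ (′-cong p)) (1′⊕x≈x _)

  ⊑-respˡ : ∀ {x y z} → x ≈ y → x ⊑ z → y ⊑ z
  ⊑-respˡ p q = trans (⊕-congʳ (′-cong (sym p))) q

  ⊑-respʳ : ∀ {x y z} → y ≈ z → x ⊑ y → x ⊑ z
  ⊑-respʳ p q = trans (⊕-congˡ (sym p)) q

  ⊑-refl : ∀ x → x ⊑ x
  ⊑-refl x = begin
    x ′ ⊕ x                    ≈⟨ ⊕-congʳ (trans (BA1 _) (′-cong (BA1 x))) ⟨
    ((x ⊕ 0#) ′ ⊕ 0#) ⊕ x      ≈⟨ BA4-0 x 0# ⟩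
    1#                         ∎

  ⊑-antisym : ∀ {x y} → x ⊑ y → y ⊑ x → x ≈ y
  ⊑-antisym {x} {y} p q = trans (sym (⊑⇒+≈ q)) (trans (BA3 y x) (⊑⇒+≈ p))

  x⊑x+y : ∀ x y → x ⊑ x + y
  x⊑x+y x y = begin
    x ′ ⊕ j                        ≈⟨ 1′⊕x≈x _ ⟨
    1# ′ ⊕ (x ′ ⊕ j)               ≈⟨ ⊕-congʳ (′-cong (⊑-refl j)) ⟨
    (j ′ ⊕ j) ′ ⊕ (x ′ ⊕ j)        ≈⟨ BA4 (x ′) y j ⟩
    1#                             ∎
    where j = x + y

  y⊑x+y : ∀ x y → y ⊑ x + y
  y⊑x+y x y = ⊑-respʳ (BA3 y x) (x⊑x+y y x)

  +≈⇒⊑ : ∀ {x y} → x + y ≈ y → x ⊑ y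
  +≈⇒⊑ {x} {y} p = ⊑-respʳ p (x⊑x+y x y)

  N-antitone : ∀ {x y} z → x ⊑ y → y ′ ⊕ z ⊑ x ′ ⊕ z
  N-antitone {x} {y} z p = begin
    (y ′ ⊕ z) ′ ⊕ (x ′ ⊕ z)          ≈⟨ ⊕-congʳ (′-cong (⊕-congʳ (′-cong (⊑⇒+≈ p)))) ⟨
    ((x + y) ′ ⊕ z) ′ ⊕ (x ′ ⊕ z)    ≈⟨ BA4 (x ′) y z ⟩
    1#                               ∎

  ⊑-trans : ∀ {x y z} → x ⊑ y → y ⊑ z → x ⊑ z
  ⊑-trans {x} {y} {z} p q = begin
    x ′ ⊕ z                  ≈⟨ 1′⊕x≈x _ ⟨
    1# ′ ⊕ (x ′ ⊕ z)         ≈⟨ ⊕-congʳ (′-cong q) ⟨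
    (y ′ ⊕ z) ′ ⊕ (x ′ ⊕ z)  ≈⟨ N-antitone z p ⟩
    1#                       ∎

  +-least : ∀ {x y z} → x ⊑ z → y ⊑ z → x + y ⊑ z
  +-least {x} {y} {z} p q =
    ⊑-respʳ (trans (BA3 z y) (⊑⇒+≈ q)) (N-antitone y (N-antitone y p))

  ′-antitone : ∀ {x y} → x ⊑ y → y ′ ⊑ x ′
  ′-antitone p = ⊑-respˡ (BA1 _) (⊑-respʳ (BA1 _) (N-antitone 0# p))

  -- x ↦ x ′ ⊕ z is a Galois connection of the induced order with its dual.
  galois : ∀ {u x} z → u ⊑ x ′ ⊕ z → x ⊑ u ′ ⊕ z
  galois {u} {x} z p = ⊑-trans (x⊑x+y x z) (N-antitone z p)

  +-assoc : Associative _≈_ _+_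
  +-assoc x y z = ⊑-antisym
    (+-least
      (+-least (x⊑x+y x _) (⊑-trans (x⊑x+y y z) (y⊑x+y x _)))
      (⊑-trans (y⊑x+y y z) (y⊑x+y x _)))
    (+-least
      (⊑-trans (x⊑x+y x y) (x⊑x+y _ z))
      (+-least (⊑-trans (y⊑x+y x y) (x⊑x+y _ z)) (y⊑x+y _ z)))

  +-identityˡ : ∀ x → 0# + x ≈ x
  +-identityˡ = 1⊕x′⊕x

  +-identityʳ : ∀ x → x + 0# ≈ x
  +-identityʳ x = trans (BA3 x 0#) (+-identityˡ x)

  *-identityˡ : ∀ x → 1# * x ≈ x
  *-identityˡ x = trans (′-cong (1′⊕x≈x _)) (BA2 x)

  *-identityʳ : ∀ x → x * 1# ≈ x
  *-identityʳ x = trans (′-cong (trans (⊕-congˡ 1′≈0) (BA1 _))) (BA2 x)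

  zeroˡ : ∀ x → 0# * x ≈ 0#
  zeroˡ x = trans (′-cong (1⊕x≈1 _)) 1′≈0

  zeroʳ : ∀ x → x * 0# ≈ 0#
  zeroʳ x = trans (′-cong (x⊕1≈1 _)) 1′≈0

  *-monoˡ : ∀ {x y} z → x ⊑ y → x * z ⊑ y * z
  *-monoˡ z p = ′-antitone (N-antitone (z ′) p)

  distribʳ : _DistributesOverʳ_ _≈_ _*_ _+_
  distribʳ z x y = ⊑-antisym
    (⊑-respʳ (BA2 s) (′-antitone (galois (z ′) (+-least x⊑ y⊑))))
    (+-least (*-monoˡ z (x⊑x+y x y)) (*-monoˡ z (y⊑x+y x y)))
    where
    s = x * z + y * z

    x⊑ : x ⊑ s ′ ′ ⊕ z ′
    x⊑ = galois (z ′) (⊑-respʳ (BA2 _) (′-antitone (x⊑x+y (x * z) (y * z))))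

    y⊑ : y ⊑ s ′ ′ ⊕ z ′
    y⊑ = galois (z ′) (⊑-respʳ (BA2 _) (′-antitone (y⊑x+y (x * z) (y * z))))

  łuk : ∀ x y → (x * y ′) ′ * y ′ ≈ (x + y) ′
  łuk x y = ′-cong (⊕-cong (′-cong (trans (BA2 _) (⊕-congˡ (BA2 y)))) (BA2 y))

  łukasiewiczNearSemiring : ŁukasiewiczNearSemiring c ℓ
  łukasiewiczNearSemiring = record
    { Carrier = Carrier
    ; _≈_     = _≈_
    ; _+_     = _+_
    ; _*_     = _*_
    ; α       = _′
    ; 0#      = 0#
    ; 1#      = 1#
    ; isŁukasiewiczNearSemiring = record
      { isInvolutiveNearSemiring = record
        { isIdempotentNearSemiring = record
          { isUnitalNearSemiring = record
            { +-isCommutativeMonoid = record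
              { isMonoid = record
                { isSemigroup = record
                  { isMagma = record
                    { isEquivalence = isEquivalence
                    ; ∙-cong = +-cong
                    }
                  ; assoc = +-assoc
                  }
                ; identity = +-identityˡ , +-identityʳ
                }
              ; comm = BA3
              }
            ; *-cong = λ p q → ′-cong (⊕-cong (′-cong p) (′-cong q))
            ; *-identity = *-identityˡ , *-identityʳ
            ; distribʳ = distribʳ
            ; zero = zeroˡ , zeroʳ
            }
          ; +-idem = λ x → ⊑⇒+≈ (⊑-refl x)
          }
        ; α-cong = ′-cong
        ; α-involutive = BA2
        ; α-antitone = λ p → ⊑⇒+≈ (′-antitone (+≈⇒⊑ p))
        }
      ; łukasiewicz = λ x y → trans (łuk x y) (trans (′-cong (BA3 x y)) (sym (łuk y x)))
      }
    }

𝐁 : ŁukasiewiczNearSemiring c ℓ → BasicAlgebra c ℓ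
𝐁 R = FromŁukasiewicz.basicAlgebra R

𝐑 : BasicAlgebra c ℓ → ŁukasiewiczNearSemiring c ℓ
𝐑 B = FromBasicAlgebra.łukasiewiczNearSemiring B

{-# OPTIONS --safe #-}
module Submission where

open import Defs
open import Data.Product using (_×_; _,_)
import Relation.Binary.Reasoning.Setoid as SetoidReasoning

-- In a basic algebra x ⊕ y dominates y, so joining it with y changes nothing;
-- B(R(B)) computes x ⊕ y as exactly this join.  In a Łukasiewicz near semiring
-- x * y is recovered as (x + α y) * y, and α y * y vanishes.

module _ {c ℓ} (B : BasicAlgebra c ℓ) where
  open BasicAlgebra B
  open FromBasicAlgebra B
  open SetoidReasoning setoid

  -- Apply the antitone map `u ↦ u ′ ⊕ y` to `x ′ ⊑ 1#`: the images are `1# ′ ⊕ y`, which is `y`,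
  -- and `x ′ ′ ⊕ y`, which is `x ⊕ y`.
  y⊑x⊕y : ∀ x y → y ⊑ x ⊕ y
  y⊑x⊕y x y =
    ⊑-respˡ (1′⊕x≈x y) (⊑-respʳ (⊕-congʳ (BA2 x)) (N-antitone y (x⊕1≈1 _)))

  [x⊕y]+y≈x⊕y : ∀ x y → (x ⊕ y) + y ≈ x ⊕ y
  [x⊕y]+y≈x⊕y x y = trans (BA3 (x ⊕ y) y) (⊑⇒+≈ (y⊑x⊕y x y))

  ⊕-recovered : ∀ x y → ((x ′ + y) * y ′) ′ ≈ x ⊕ y
  ⊕-recovered x y = begin
    ((x ′ + y) * y ′) ′    ≈⟨ BA2 _ ⟩
    (x ′ + y) ′ ⊕ y ′ ′    ≈⟨ ⊕-congˡ (BA2 y) ⟩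
    -- Here `x ′ + y` unfolds to `(x ′ ′ ⊕ y) ′ ⊕ y`; once `x ′ ′` is reduced, the whole term is by
    -- definition a join with `y`.
    (x ′ + y) ′ ⊕ y        ≈⟨ ⊕-congʳ (′-cong (⊕-congʳ (′-cong (⊕-congʳ (BA2 x))))) ⟩
    (x ⊕ y) + y            ≈⟨ [x⊕y]+y≈x⊕y x y ⟩
    x ⊕ y                  ∎

module _ {c ℓ} (R : ŁukasiewiczNearSemiring c ℓ) where
  open ŁukasiewiczNearSemiring R
  open FromŁukasiewicz R
  open SetoidReasoning setoid

  αx*x≈0 : ∀ x → α x * x ≈ 0#
  αx*x≈0 x = trans (*-congˡ (sym (α-involutive x))) (x*αx≈0 (α x))

  *-recovered : ∀ x y → α (α x ⊕ α y) ≈ x * y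
  *-recovered x y = begin
    α (α x ⊕ α y)                    ≈⟨ α-involutive _ ⟩
    (α (α x) + α y) * α (α y)        ≈⟨ *-cong (+-cong (α-involutive x) refl) (α-involutive y) ⟩
    -- The sum is the left factor, so right distributivity applies.
    (x + α y) * y                    ≈⟨ distribʳ y x (α y) ⟩
    x * y + α y * y                  ≈⟨ +-cong refl (αx*x≈0 y) ⟩
    x * y + 0#                       ≈⟨ +-identityʳ _ ⟩
    x * y                            ∎

theorem6 : ∀ {c ℓ} →
    ((B : BasicAlgebra c ℓ) →
      let open BasicAlgebra B
          module BRB = BasicAlgebra (𝐁 (𝐑 B)) in
      (∀ (x y : Carrier) → (x BRB.⊕ y) ≈ (x ⊕ y)) ×
      (∀ (x : Carrier) → (x BRB.′) ≈ (x ′)) ×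
      (BRB.0# ≈ 0#))
    ×
    ((R : ŁukasiewiczNearSemiring c ℓ) →
      let open ŁukasiewiczNearSemiring R
          module RBR = ŁukasiewiczNearSemiring (𝐑 (𝐁 R)) in
      (∀ (x y : Carrier) → (x RBR.+ y) ≈ (x + y)) ×
      (∀ (x y : Carrier) → (x RBR.* y) ≈ (x * y)) ×
      (∀ (x : Carrier) → RBR.α x ≈ α x) ×
      (RBR.0# ≈ 0#) ×
      (RBR.1# ≈ 1#))
theorem6 =
  (λ B → let open BasicAlgebra B in
    ⊕-recovered B , (λ _ → refl) , refl) ,
  (λ R → let open ŁukasiewiczNearSemiring R
             open FromŁukasiewicz R using (join; α0≈1) in
    -- Involution and zero pass through both constructions unchanged, whereas the unit is rebuilt as
    -- `α 0#`, hence `α0≈1`.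
    join , *-recovered R , (λ _ → refl) , refl , α0≈1)
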